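{- For a permutation $w\in\mathfrak{S}_n$, the length and the reflection length of $w$ agree, i.e. $\ell_S(w)=\ell_T(w)$, if and only if $w$ avoids both of the patterns $321$ and $3412$.
   Context: $\mathfrak{S}_n$ is the group of permutations of $\{1,\dots,n\}$. The length $\ell_S(w)$ is the minimal number of factors in an expression of $w$ as a product of adjacent transpositions $s_i=(i\ i+1)$; the reflection length $\ell_T(w)$ is the minimal number of factors in an expression of $w$ as a product of arbitrary transpositions $(i\ j)$. For $p\in\mathfrak{S}_k$, the permutation $w$ contains the pattern $p$ if there are indices $i_1<\cdots<i_k$ such that $w(i_1)\cdots w(i_k)$ is in the same relative order as $p(1)\cdots p(k)$; otherwise $w$ avoids $p$. -}

module Defs where

open import Data.Fin using (Fin; zero; suc; toℕ; _<_)
open import Data.Fin.Patterns using (0F; 1F; 2F; 3F)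
open import Data.Fin.Properties using (_≟_; all?; any?)
open import Data.Fin.Permutation as Perm
  using (Permutation′; permutation; _⟨$⟩ʳ_; _⟨$⟩ˡ_; _∘ₚ_; _≈_; flip; remove;
         transpose; inverseˡ; inverseʳ; lift₀-remove; lift₀-cong)
open import Data.Fin.Permutation.Transposition.List
  using (TranspositionList; lift₀; eval; eval-lift)
open import Data.List using ([]; _∷_; _++_; length)
open import Data.List.Relation.Unary.All as All using (All; []; _∷_)
open import Data.List.Relation.Unary.All.Properties using (++⁺; map⁺)
open import Data.Nat as ℕ using (ℕ; zero; suc; _≤_; z≤n; s≤s)
open import Data.Nat.Properties using (suc-injective; 1+n≢n)
open import Data.Product using (Σ; ∃-syntax; _×_; _,_; proj₁; proj₂)
open import Data.Vec using (lookup; []; _∷_)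
open import Function using (_∘_; _⇔_)
open import Relation.Binary.Core using (_Preserves_⟶_)
open import Relation.Binary.PropositionalEquality
  using (_≡_; _≢_; refl; sym; trans; cong; module ≡-Reasoning)
open import Relation.Nullary using (Dec; yes; no; ¬_; contradiction; ¬?; _×-dec_)
import Relation.Nullary.Decidable as Dec
open import Relation.Unary using (Pred; Decidable)
open import Level using (0ℓ)

private
  variable
    k n : ℕ

-- The library's `transpose i i` is the identity, so i ≢ j has to be required.
IsTransposition : Pred (Fin n × Fin n) 0ℓ
IsTransposition (i , j) = i ≢ j

IsAdjacent : Pred (Fin n × Fin n) 0ℓ
IsAdjacent (i , j) = toℕ j ≡ suc (toℕ i)

-- `eval` composes left to right.  The opposite convention reverses the words,
-- so it gives the same set of products of k factors.
ProductOf : Pred (Fin n × Fin n) 0ℓ → Permutation′ n → ℕ → Set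
ProductOf {n} G w k =
  Σ (TranspositionList n) λ ts → length ts ≡ k × All G ts × eval ts ≈ w

Least : Pred ℕ 0ℓ → Set
Least P = ∃[ m ] (P m × (∀ j → P j → m ≤ j))

least : {P : Pred ℕ 0ℓ} → Decidable P → ∀ k → P k → Least P
least P? k pk with P? 0
least P? k       pk | yes p0 = 0 , p0 , λ _ _ → z≤n
least P? zero    pk | no ¬p0 = contradiction pk ¬p0
least P? (suc k) pk | no ¬p0 with m , pm , m≤ ← least (P? ∘ suc) k pk =
  suc m , pm , λ where
    zero    p0 → contradiction p0 ¬p0
    (suc j) pj → s≤s (m≤ j pj)

-- There are finitely many words of a given length.
anyWord? : {G : Pred (Fin n × Fin n) 0ℓ} → Decidable G →
           {Q : Pred (TranspositionList n) 0ℓ} → Decidable Q →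
           ∀ k → Dec (Σ (TranspositionList n) λ ts → length ts ≡ k × All G ts × Q ts)
anyWord? G? Q? zero =
  Dec.map′ (λ q → [] , refl , [] , q) (λ { ([] , _ , _ , q) → q }) (Q? [])
anyWord? G? Q? (suc k) =
  Dec.map′
    (λ (i , j , g , ts , l , gs , q) → (i , j) ∷ ts , cong suc l , g ∷ gs , q)
    (λ { ((i , j) ∷ ts , l , g ∷ gs , q) → i , j , g , ts , suc-injective l , gs , q })
    (any? λ i → any? λ j →
      G? (i , j) ×-dec anyWord? G? (λ ts → Q? ((i , j) ∷ ts)) k)

productOf? : {G : Pred (Fin n × Fin n) 0ℓ} → Decidable G →
             (w : Permutation′ n) → Decidable (ProductOf G w)
productOf? G? w = anyWord? G? λ ts → all? λ i → eval ts ⟨$⟩ʳ i ≟ w ⟨$⟩ʳ i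

eval-++ : (xs ys : TranspositionList n) → eval (xs ++ ys) ≈ eval xs ∘ₚ eval ys
eval-++ []             ys i = refl
eval-++ ((a , b) ∷ xs) ys i = eval-++ xs ys (transpose a b ⟨$⟩ʳ i)

lift₀-adjacent : {ts : TranspositionList n} → All IsAdjacent ts → All IsAdjacent (lift₀ ts)
lift₀-adjacent as = map⁺ (All.map (cong suc) as)

moveToFront : (i : Fin (suc n)) →
  Σ (TranspositionList (suc n)) λ ts → All IsAdjacent ts × eval ts ⟨$⟩ʳ i ≡ 0F
moveToFront zero = [] , [] , refl
moveToFront {suc n} (suc i) with ts , as , ts-i ← moveToFront i =
  lift₀ ts ++ (0F , 1F) ∷ [] , ++⁺ (lift₀-adjacent as) (refl ∷ []) , (begin
    eval (lift₀ ts ++ (0F , 1F) ∷ []) ⟨$⟩ʳ suc i        ≡⟨ eval-++ (lift₀ ts) _ (suc i) ⟩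
    transpose 0F 1F ⟨$⟩ʳ (eval (lift₀ ts) ⟨$⟩ʳ suc i)   ≡⟨ cong (transpose 0F 1F ⟨$⟩ʳ_) (eval-lift ts (suc i)) ⟩
    transpose 0F 1F ⟨$⟩ʳ suc (eval ts ⟨$⟩ʳ i)           ≡⟨ cong (λ x → transpose 0F 1F ⟨$⟩ʳ suc x) ts-i ⟩
    0F                                                  ∎)
  where open ≡-Reasoning

adjacentWord : (w : Permutation′ n) →
  Σ (TranspositionList n) λ ts → All IsAdjacent ts × eval ts ≈ w
adjacentWord {zero}  w = [] , [] , λ ()
adjacentWord {suc n} w
  with cs , as , cs-i ← moveToFront (w ⟨$⟩ˡ 0F)
  with rs , bs , rs≈ ← adjacentWord (remove 0F (flip (eval cs) ∘ₚ w)) =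
  cs ++ lift₀ rs , ++⁺ as (lift₀-adjacent bs) , λ i → begin
    eval (cs ++ lift₀ rs) ⟨$⟩ʳ i                      ≡⟨ eval-++ cs (lift₀ rs) i ⟩
    eval (lift₀ rs) ⟨$⟩ʳ (c ⟨$⟩ʳ i)                   ≡⟨ eval-lift rs (c ⟨$⟩ʳ i) ⟩
    Perm.lift₀ (eval rs) ⟨$⟩ʳ (c ⟨$⟩ʳ i)              ≡⟨ lift₀-cong _ _ rs≈ (c ⟨$⟩ʳ i) ⟩
    Perm.lift₀ (remove 0F u) ⟨$⟩ʳ (c ⟨$⟩ʳ i)          ≡⟨ lift₀-remove u u-0 (c ⟨$⟩ʳ i) ⟩
    w ⟨$⟩ʳ (c ⟨$⟩ˡ (c ⟨$⟩ʳ i))                        ≡⟨ cong (w ⟨$⟩ʳ_) (inverseˡ c) ⟩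
    w ⟨$⟩ʳ i                                          ∎
  where
  open ≡-Reasoning
  c = eval cs
  u = flip c ∘ₚ w
  u-0 : u ⟨$⟩ʳ 0F ≡ 0F
  u-0 = begin
    w ⟨$⟩ʳ (c ⟨$⟩ˡ 0F)                                ≡⟨ cong (λ x → w ⟨$⟩ʳ (c ⟨$⟩ˡ x)) cs-i ⟨
    w ⟨$⟩ʳ (c ⟨$⟩ˡ (c ⟨$⟩ʳ (w ⟨$⟩ˡ 0F)))              ≡⟨ cong (w ⟨$⟩ʳ_) (inverseˡ c) ⟩
    w ⟨$⟩ʳ (w ⟨$⟩ˡ 0F)                                ≡⟨ inverseʳ w ⟩
    0F                                                ∎

adjacent⇒transposition : {t : Fin n × Fin n} → IsAdjacent t → IsTransposition t
adjacent⇒transposition adj refl = 1+n≢n (sym adj)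

leastS : (w : Permutation′ n) → Least (ProductOf IsAdjacent w)
leastS w with ts , as , ts≈w ← adjacentWord w =
  least (productOf? (λ (i , j) → toℕ j ℕ.≟ suc (toℕ i)) w)
        (length ts) (ts , refl , as , ts≈w)

leastT : (w : Permutation′ n) → Least (ProductOf IsTransposition w)
leastT w with ts , as , ts≈w ← adjacentWord w =
  least (productOf? (λ (i , j) → ¬? (i ≟ j)) w)
        (length ts) (ts , refl , All.map adjacent⇒transposition as , ts≈w)

ℓS : Permutation′ n → ℕ
ℓS w = proj₁ (leastS w)

ℓT : Permutation′ n → ℕ
ℓT w = proj₁ (leastT w)

_Contains_ : Permutation′ n → Permutation′ k → Set
_Contains_ {n} {k} w p =
  Σ (Fin k → Fin n) λ i →
    i Preserves _<_ ⟶ _<_ ×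
    (∀ a b → (w ⟨$⟩ʳ i a) < (w ⟨$⟩ʳ i b) ⇔ (p ⟨$⟩ʳ a) < (p ⟨$⟩ʳ b))

_Avoids_ : Permutation′ n → Permutation′ k → Set
w Avoids p = ¬ (w Contains p)

-- One-line notation, shifted to start at 0.  Both patterns are involutions.
p321 : Permutation′ 3
p321 = permutation f f inv inv
  where
  f : Fin 3 → Fin 3
  f = lookup (2F ∷ 1F ∷ 0F ∷ [])
  inv : ∀ i → f (f i) ≡ i
  inv 0F = refl
  inv 1F = refl
  inv 2F = refl

p3412 : Permutation′ 4
p3412 = permutation f f inv inv
  where
  f : Fin 4 → Fin 4
  f = lookup (2F ∷ 3F ∷ 0F ∷ 1F ∷ [])
  inv : ∀ i → f (f i) ≡ i
  inv 0F = refl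
  inv 1F = refl
  inv 2F = refl
  inv 3F = refl

{-# OPTIONS --safe #-}
-- The two lengths agree exactly when w is a product of distinct adjacent
-- transpositions.  Products are read from left to right.
--
-- If a letter t occurs twice in a word, the factors between the two occurrences
-- can be conjugated by t and both occurrences dropped; so if ℓS w = ℓT w, the
-- letters of a shortest adjacent word of w are distinct.  In w = sᵢ v with v a
-- product of letters other than sᵢ, the permutation v preserves the block
-- {0,…,i}; this excludes an occurrence of 321 or 3412 at positions including both
-- i and i+1, and any other occurrence gives one in v.
--
-- Conversely, a word of m transpositions on {0,…,n} equals u (0 k), with u fixing
-- 0, or u alone if 0 is fixed; u is a product of at most m ∸ 1, respectively m,
-- transpositions.  Avoidance of 321 and 3412 forces k = 1 or w(1) = 0 when 0 is
-- moved, so w is u (0 1) or (0 1) u, where u is again a pattern of w.  Induction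
-- on n turns u, hence w, into an adjacent word that is not longer.
module Submission where

open import Defs
open import Data.Fin using (Fin; zero; suc; toℕ; inject₁; punchIn; _<_)
open import Data.Fin.Patterns using (0F; 1F; 2F; 3F)
open import Data.Fin.Permutation as Perm
  using (Permutation′; _⟨$⟩ʳ_; _⟨$⟩ˡ_; _∘ₚ_; _≈_; transpose; inverseˡ; inverseʳ;
         lift₀-transpose; lift₀-cong)
open import Data.Fin.Permutation.Components using (transpose-inverse)
open import Data.Fin.Permutation.Transposition.List
  using (TranspositionList; lift₀; eval; eval-lift)
open import Data.Fin.Properties
  using (_≟_; any?; <-cmp; <-asym; <-irrefl; <-trans; <⇒≢; toℕ-injective; toℕ-inject₁;
         suc-injective)
open import Data.List using ([]; _∷_; _++_; length)
open import Data.List.Membership.Propositional using (_∈_)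
open import Data.List.Properties using (length-++; length-map)
open import Data.List.Relation.Unary.All as All using (All; []; _∷_)
open import Data.List.Relation.Unary.All.Properties using (++⁺; ¬Any⇒All¬)
open import Data.List.Relation.Unary.AllPairs using ([]; _∷_)
open import Data.List.Relation.Unary.Any using (here; there)
open import Data.List.Relation.Unary.Unique.Propositional using (Unique)
open import Data.Nat as ℕ using (ℕ; zero; suc; _≤_; z≤n; s≤s; z<s)
import Data.Nat.Properties as ℕₚ
open import Data.Product using (Σ; ∃-syntax; ∃₂; _×_; _,_; proj₂)
open import Data.Sum using (_⊎_; inj₁; inj₂; [_,_])
open import Data.Vec using (lookup; []; _∷_)
open import Function using (_∘_; mk⇔; Injection)
open import Function.Bundles using (_⇔_; Equivalence)
open import Function.Construct.Composition using (_⇔-∘_)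
open import Function.Properties.Inverse using (↔⇒↣)
open import Relation.Binary.Core using (_Preserves_⟶_)
open import Relation.Binary.Definitions using (tri<; tri≈; tri>)
open import Relation.Binary.PropositionalEquality
  using (_≡_; _≢_; refl; sym; trans; cong; cong₂; subst; subst₂; module ≡-Reasoning)
open import Relation.Nullary using (Dec; yes; no; ¬_; contradiction; _×-dec_)

private
  variable
    k m n : ℕ

-- Transpositions and their conjugates.

⟨$⟩ʳ-injective : (w : Permutation′ n) {x y : Fin n} → w ⟨$⟩ʳ x ≡ w ⟨$⟩ʳ y → x ≡ y
⟨$⟩ʳ-injective w = Injection.injective (↔⇒↣ w)

transpose-matchˡ : (i j : Fin n) → transpose i j ⟨$⟩ʳ i ≡ j
transpose-matchˡ i j with i ≟ i
... | yes _  = refl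
... | no i≢i = contradiction refl i≢i

transpose-matchʳ : (i j : Fin n) → transpose i j ⟨$⟩ʳ j ≡ i
transpose-matchʳ i j with j ≟ i
... | yes j≡i = j≡i
... | no _ with j ≟ j
...   | yes _  = refl
...   | no j≢j = contradiction refl j≢j

transpose-mismatch : {i j x : Fin n} → x ≢ i → x ≢ j → transpose i j ⟨$⟩ʳ x ≡ x
transpose-mismatch {i = i} {j} {x} x≢i x≢j with x ≟ i
... | yes x≡i = contradiction x≡i x≢i
... | no _ with x ≟ j
...   | yes x≡j = contradiction x≡j x≢j
...   | no _    = refl

transpose-comm : (i j : Fin n) → transpose i j ≈ transpose j i
transpose-comm i j x = compare (x ≟ i) (x ≟ j)
  where
  compare : Dec (x ≡ i) → Dec (x ≡ j) → transpose i j ⟨$⟩ʳ x ≡ transpose j i ⟨$⟩ʳ x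
  compare (yes refl) _          = trans (transpose-matchˡ x j) (sym (transpose-matchʳ j x))
  compare (no x≢i)   (yes refl) = trans (transpose-matchʳ i x) (sym (transpose-matchˡ x i))
  compare (no x≢i)   (no x≢j)   = trans (transpose-mismatch x≢i x≢j) (sym (transpose-mismatch x≢j x≢i))

transpose-involutive : (i j : Fin n) → transpose i j ∘ₚ transpose i j ≈ Perm.id
transpose-involutive i j x =
  trans (cong (transpose i j ⟨$⟩ʳ_) (transpose-comm i j x)) (transpose-inverse i j)

-- Conjugating `(i j)` by `w` relabels its two entries. In this form, without inverses, the identity
-- moves a transposition past `w`.
transpose-natural : (w : Permutation′ n) (i j : Fin n) →
  transpose i j ∘ₚ w ≈ w ∘ₚ transpose (w ⟨$⟩ʳ i) (w ⟨$⟩ʳ j)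
transpose-natural w i j x with x ≟ i
... | yes refl = sym (transpose-matchˡ (w ⟨$⟩ʳ x) (w ⟨$⟩ʳ j))
... | no x≢i with x ≟ j
...   | yes refl = sym (transpose-matchʳ (w ⟨$⟩ʳ i) (w ⟨$⟩ʳ x))
...   | no x≢j   = sym (transpose-mismatch (x≢i ∘ ⟨$⟩ʳ-injective w) (x≢j ∘ ⟨$⟩ʳ-injective w))

-- Patterns

steps⇒monotone : (f : Fin (suc k) → Fin n) →
  (∀ x → f (inject₁ x) < f (suc x)) → f Preserves _<_ ⟶ _<_
steps⇒monotone f f< {zero}  {suc zero}    _ = f< 0F
steps⇒monotone f f< {zero}  {suc (suc y)} _ =
  <-trans (f< 0F) (steps⇒monotone (f ∘ suc) (f< ∘ suc) z<s)
steps⇒monotone {k = suc k} f f< {suc x} {suc y} (s≤s x<y) =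
  steps⇒monotone (f ∘ suc) (f< ∘ suc) x<y

monotone⇒reflects : (f : Fin m → Fin n) → f Preserves _<_ ⟶ _<_ →
  ∀ {x y} → f x < f y → x < y
monotone⇒reflects f f< {x} {y} fx<fy with <-cmp x y
... | tri< x<y _ _  = x<y
... | tri≈ _ refl _ = contradiction fx<fy (<-irrefl refl)
... | tri> _ _ y<x  = contradiction fx<fy (<-asym (f< y<x))

-- `f` lists the positions and `g` the values of the occurrence, both in increasing order.
embedding⇒contains : (w : Permutation′ n) (p : Permutation′ k) (f g : Fin k → Fin n) →
  f Preserves _<_ ⟶ _<_ → g Preserves _<_ ⟶ _<_ →
  (∀ x → w ⟨$⟩ʳ f x ≡ g (p ⟨$⟩ʳ x)) → w Contains p
embedding⇒contains w p f g f< g< wf≡gp = f , f< , λ a b → mk⇔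
  (λ lt → monotone⇒reflects g g< (subst₂ _<_ (wf≡gp a) (wf≡gp b) lt))
  (λ lt → subst₂ _<_ (sym (wf≡gp a)) (sym (wf≡gp b)) (g< lt))

-- Neighbouring positions and neighbouring values suffice: `f (p ⟨$⟩ˡ y)` is the position whose
-- value has rank `y` in the occurrence.
steps⇒contains : (w : Permutation′ n) (p : Permutation′ (suc k)) (f : Fin (suc k) → Fin n) →
  (∀ x → f (inject₁ x) < f (suc x)) →
  (∀ x → w ⟨$⟩ʳ f (p ⟨$⟩ˡ inject₁ x) < w ⟨$⟩ʳ f (p ⟨$⟩ˡ suc x)) → w Contains p
steps⇒contains w p f f< wf< =
  embedding⇒contains w p f (λ y → w ⟨$⟩ʳ f (p ⟨$⟩ˡ y))
    (steps⇒monotone _ f<) (steps⇒monotone _ wf<)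
    (λ x → cong (λ y → w ⟨$⟩ʳ f y) (sym (inverseˡ p)))

contains-trans : (w : Permutation′ n) (u : Permutation′ m) (p : Permutation′ k) →
  w Contains u → u Contains p → w Contains p
contains-trans w u p (f , f< , w⇔u) (g , g< , u⇔p) =
  f ∘ g , f< ∘ g< , λ a b → u⇔p a b ⇔-∘ w⇔u (g a) (g b)

contains321 : (w : Permutation′ n) {x y z : Fin n} → x < y → y < z →
  w ⟨$⟩ʳ z < w ⟨$⟩ʳ y → w ⟨$⟩ʳ y < w ⟨$⟩ʳ x → w Contains p321
contains321 w {x} {y} {z} x<y y<z wz<wy wy<wx =
  steps⇒contains w p321 (lookup (x ∷ y ∷ z ∷ []))
    (λ { 0F → x<y ; 1F → y<z }) (λ { 0F → wz<wy ; 1F → wy<wx })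

contains3412 : (w : Permutation′ n) {x y z t : Fin n} → x < y → y < z → z < t →
  w ⟨$⟩ʳ z < w ⟨$⟩ʳ t → w ⟨$⟩ʳ t < w ⟨$⟩ʳ x → w ⟨$⟩ʳ x < w ⟨$⟩ʳ y → w Contains p3412
contains3412 w {x} {y} {z} {t} x<y y<z z<t wz<wt wt<wx wx<wy =
  steps⇒contains w p3412 (lookup (x ∷ y ∷ z ∷ t ∷ []))
    (λ { 0F → x<y ; 1F → y<z ; 2F → z<t }) (λ { 0F → wz<wt ; 1F → wt<wx ; 2F → wx<wy })

-- Equal lengths force avoidance

-- The competitors are words in arbitrary transpositions, even for an adjacent word `ts`, because
-- cancelling a repeated letter conjugates others and may leave the adjacent ones.
Minimal : TranspositionList n → Set
Minimal ts = ∀ us → All IsTransposition us → eval us ≈ eval ts → length ts ≤ length us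

cancelRepeated : {t : Fin n × Fin n} {ts : TranspositionList n} →
  All IsTransposition ts → t ∈ ts →
  ∃[ us ] (All IsTransposition us × suc (length us) ≡ length ts × eval us ≈ eval (t ∷ ts))
cancelRepeated {t = i , j} {_ ∷ ts} (_ ∷ T) (here refl) =
  ts , T , refl , λ x → cong (eval ts ⟨$⟩ʳ_) (sym (transpose-involutive i j x))
cancelRepeated {t = i , j} {(a , b) ∷ ts} (a≢b ∷ T) (there t∈ts)
  with us , U , len , us≈ ← cancelRepeated T t∈ts =
  -- Replacing `(a b)` by its conjugate lets `τ` move past it, one letter closer to its second
  -- occurrence.
  (τ ⟨$⟩ʳ a , τ ⟨$⟩ʳ b) ∷ us , a≢b ∘ ⟨$⟩ʳ-injective τ ∷ U , cong suc len , λ x → begin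
    eval us ⟨$⟩ʳ (τab ⟨$⟩ʳ x)                ≡⟨ us≈ (τab ⟨$⟩ʳ x) ⟩
    eval ts ⟨$⟩ʳ (τ ⟨$⟩ʳ (τab ⟨$⟩ʳ x))       ≡⟨ cong (eval ts ⟨$⟩ʳ_) (transpose-natural τ _ _ x) ⟩
    eval ts ⟨$⟩ʳ (transpose (τ ⟨$⟩ʳ (τ ⟨$⟩ʳ a)) (τ ⟨$⟩ʳ (τ ⟨$⟩ʳ b)) ⟨$⟩ʳ (τ ⟨$⟩ʳ x))
      ≡⟨ cong₂ (λ c d → eval ts ⟨$⟩ʳ (transpose c d ⟨$⟩ʳ (τ ⟨$⟩ʳ x)))
               (transpose-involutive i j a) (transpose-involutive i j b) ⟩
    eval ts ⟨$⟩ʳ (transpose a b ⟨$⟩ʳ (τ ⟨$⟩ʳ x)) ∎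
  where
  open ≡-Reasoning
  τ = transpose i j
  τab = transpose (τ ⟨$⟩ʳ a) (τ ⟨$⟩ʳ b)

minimal-tail : {t : Fin n × Fin n} {ts : TranspositionList n} →
  IsTransposition t → Minimal (t ∷ ts) → Minimal ts
minimal-tail {t = i , j} i≢j min us U us≈ =
  ℕ.s≤s⁻¹ (min ((i , j) ∷ us) (i≢j ∷ U) (us≈ ∘ (transpose i j ⟨$⟩ʳ_)))

minimal⇒unique : {ts : TranspositionList n} →
  All IsTransposition ts → Minimal ts → Unique ts
minimal⇒unique []        min = []
minimal⇒unique {ts = t ∷ ts} (t-ok ∷ T) min =
  ¬Any⇒All¬ ts t∉ts ∷ minimal⇒unique T (minimal-tail {t = t} {ts} t-ok min)
  where
  t∉ts : ¬ (t ∈ ts)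
  t∉ts t∈ts with us , U , len , us≈ ← cancelRepeated T t∈ts =
    ℕₚ.<⇒≱ (ℕₚ.m≤n⇒m≤1+n (ℕₚ.≤-reflexive len)) (min us U us≈)

-- Only the adjacent transposition starting at `i` carries a point across the boundary between `i`
-- and its successor.
adjacent-≤ : (a b i x : Fin n) → IsAdjacent (a , b) → a ≢ i →
  toℕ x ≤ toℕ i → toℕ (transpose a b ⟨$⟩ʳ x) ≤ toℕ i
adjacent-≤ a b i x b≡1+a a≢i x≤i with x ≟ a
... | yes refl = subst (_≤ toℕ i) (sym b≡1+a) (ℕₚ.≤∧≢⇒< x≤i (a≢i ∘ toℕ-injective))
... | no _ with x ≟ b
...   | yes refl = ℕₚ.≤-trans (ℕₚ.n≤1+n _) (subst (_≤ toℕ i) b≡1+a x≤i)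
...   | no _     = x≤i

eval-≤ : (i j : Fin n) → IsAdjacent (i , j) → {ts : TranspositionList n} →
  All IsAdjacent ts → All ((i , j) ≢_) ts →
  ∀ x → toℕ x ≤ toℕ i ⇔ toℕ (eval ts ⟨$⟩ʳ x) ≤ toℕ i
eval-≤ i j adj {[]} [] [] x = mk⇔ (λ x≤i → x≤i) (λ x≤i → x≤i)
eval-≤ i j adj {(a , b) ∷ ts} (adj′ ∷ A) (t≢ ∷ D) x =
  eval-≤ i j adj A D (transpose a b ⟨$⟩ʳ x) ⇔-∘ mk⇔
    (adjacent-≤ a b i x adj′ a≢i)
    -- For the converse the same bound is applied to the image of `x`, as the letter is its own
    -- inverse.
    (subst (λ y → toℕ y ≤ toℕ i) (transpose-involutive a b x)
      ∘ adjacent-≤ a b i (transpose a b ⟨$⟩ʳ x) adj′ a≢i)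
  where
  a≢i : a ≢ i
  a≢i refl = t≢ (cong (i ,_) (toℕ-injective (trans adj (sym adj′))))

-- Exchanging two neighbours reverses the order of that pair only. An occurrence of a pattern that
-- does not use both thus survives the removal of the letter.
adjacent-< : {i j x y : Fin n} → IsAdjacent (i , j) → x < y → ¬ (x ≡ i × y ≡ j) →
  (transpose i j ⟨$⟩ʳ x) < (transpose i j ⟨$⟩ʳ y)
adjacent-< {i = i} {j} {x} {y} j≡1+i x<y ¬ij with x ≟ i | y ≟ i
... | yes refl | yes refl = contradiction x<y (<-irrefl refl)
... | yes refl | no _ with y ≟ j
...   | yes refl = contradiction (refl , refl) ¬ij
...   | no y≢j   = ℕₚ.≤∧≢⇒< (subst (_≤ toℕ y) (sym j≡1+i) x<y) (y≢j ∘ sym ∘ toℕ-injective)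
adjacent-< {i = i} {j} {x} {y} j≡1+i x<y ¬ij | no x≢i | yes refl with x ≟ j
... | yes refl = contradiction x<y (ℕₚ.<-asym (ℕₚ.≤-reflexive (sym j≡1+i)))
... | no _     = ℕₚ.<-trans x<y (ℕₚ.≤-reflexive (sym j≡1+i))
adjacent-< {i = i} {j} {x} {y} j≡1+i x<y ¬ij | no x≢i | no y≢i with x ≟ j | y ≟ j
... | yes refl | yes refl = contradiction x<y (<-irrefl refl)
... | yes refl | no _     = ℕₚ.<-trans (ℕₚ.≤-reflexive (sym j≡1+i)) x<y
... | no _     | yes refl =
  ℕₚ.≤∧≢⇒< (ℕ.s≤s⁻¹ (subst (suc (toℕ x) ≤_) j≡1+i x<y)) (x≢i ∘ toℕ-injective)
... | no _     | no _     = x<y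

-- The second clause says that p is no product s_x v with v preserving {0,…,x}:
-- y is a position that s_x sends into that block, and z one that it does not.
Tangled : Permutation′ (suc k) → Set
Tangled {k} p =
  (∃₂ λ a b → a < b × (p ⟨$⟩ʳ b) < (p ⟨$⟩ʳ a)) ×
  (∀ (x : Fin k) → ∃₂ λ y z →
    (y ≡ suc x ⊎ y < inject₁ x) × (z ≡ inject₁ x ⊎ suc x < z) × (p ⟨$⟩ʳ z) < (p ⟨$⟩ʳ y))

tangled321 : Tangled p321
tangled321 = (0F , 1F , z<s , s≤s (s≤s z≤n)) , λ where
  0F → 1F , 2F , inj₁ refl , inj₂ (s≤s (s≤s z≤n)) , z<s
  1F → 0F , 1F , inj₂ z<s , inj₁ refl , s≤s (s≤s z≤n)

tangled3412 : Tangled p3412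
tangled3412 = (0F , 2F , z<s , z<s) , λ where
  0F → 1F , 2F , inj₁ refl , inj₂ (s≤s (s≤s z≤n)) , z<s
  1F → 0F , 3F , inj₂ z<s , inj₂ (s≤s (s≤s (s≤s z≤n))) , s≤s (s≤s z≤n)
  2F → 0F , 2F , inj₂ z<s , inj₁ refl , z<s

unique⇒avoids : {p : Permutation′ (suc k)} → Tangled p → {ts : TranspositionList n} →
  All IsAdjacent ts → Unique ts → eval ts Avoids p
-- The empty word is the identity, which has no inversion, while `p` inverts `a` and `b`.
unique⇒avoids ((a , b , a<b , pb<pa) , _) [] [] (f , f< , iff) =
  <-asym (f< a<b) (Equivalence.from (iff b a) pb<pa)
unique⇒avoids {p = p} tangled {(i , j) ∷ ts} (adj ∷ A) (D ∷ U) (f , f< , iff)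
  -- Since `f` is increasing, positions `i` and `j` can only be used by neighbouring entries of the
  -- pattern.
  with any? (λ x → f (inject₁ x) ≟ i ×-dec f (suc x) ≟ j)
... | no ¬ij = unique⇒avoids {p = p} tangled A U
  ( (transpose i j ⟨$⟩ʳ_) ∘ f
  , steps⇒monotone _ (λ x → adjacent-< adj (f< (s≤s (ℕₚ.≤-reflexive (toℕ-inject₁ x)))) (¬ij ∘ (x ,_)))
  , iff)
... | yes (x , refl , refl) with y , z , y-low , z-high , pz<py ← proj₂ tangled x =
  -- `τ` sends `f y` into the block {0,...,i} and `f z` above it. The remaining letters preserve the
  -- block, so the value at `f y` is the smaller one, against `pz<py`.
  ℕₚ.<-asym (Equivalence.from (iff z y) pz<py)
    (ℕₚ.≤-<-trans (Equivalence.to (block (τ ⟨$⟩ʳ f y)) (low y-low))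
                  (ℕₚ.≰⇒> (ℕₚ.<⇒≱ (high z-high) ∘ Equivalence.from (block (τ ⟨$⟩ʳ f z)))))
  where
  τ = transpose i j
  block = eval-≤ i j adj A D
  i<j : i < j
  i<j = ℕₚ.≤-reflexive (sym adj)
  low : ∀ {y} → y ≡ suc x ⊎ y < inject₁ x → toℕ (τ ⟨$⟩ʳ f y) ≤ toℕ i
  low (inj₁ refl) = ℕₚ.≤-reflexive (cong toℕ (transpose-matchʳ i j))
  low (inj₂ y<x) = subst (λ v → toℕ v ≤ toℕ i)
    (sym (transpose-mismatch (<⇒≢ (f< y<x)) (<⇒≢ (<-trans (f< y<x) i<j)))) (ℕₚ.<⇒≤ (f< y<x))
  high : ∀ {z} → z ≡ inject₁ x ⊎ suc x < z → i < (τ ⟨$⟩ʳ f z)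
  high (inj₁ refl) = subst (i <_) (sym (transpose-matchˡ i j)) i<j
  high (inj₂ x<z) = subst (i <_)
    (sym (transpose-mismatch (<⇒≢ (<-trans i<j (f< x<z)) ∘ sym) (<⇒≢ (f< x<z) ∘ sym)))
    (<-trans i<j (f< x<z))

-- Avoidance gives an adjacent word that is not longer

-- In `moved`, `suc k` is the image of 0, and the strict bound reserves one letter for the last
-- factor.
data Factorisation₀ (w : Permutation′ (suc n)) (m : ℕ) : Set where
  fixed : (us : TranspositionList n) → All IsTransposition us → length us ≤ m →
          w ≈ Perm.lift₀ (eval us) → Factorisation₀ w m
  moved : (us : TranspositionList n) (k : Fin n) → All IsTransposition us → length us ℕ.< m →
          w ≈ Perm.lift₀ (eval us) ∘ₚ transpose 0F (suc k) → Factorisation₀ w m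

factorisation-resp : {v w : Permutation′ (suc n)} → v ≈ w → Factorisation₀ w m → Factorisation₀ v m
factorisation-resp v≈w (fixed us U l w≈)   = fixed us U l (λ x → trans (v≈w x) (w≈ x))
factorisation-resp v≈w (moved us k U l w≈) = moved us k U l (λ x → trans (v≈w x) (w≈ x))

-- Moved past the part fixing 0, the new letter still involves 0. If it meets a second letter of
-- this kind, equal letters cancel; otherwise, up to the shift by `suc`,
-- `(0 j′)(0 k) = (j′ k)(0 j′)` leaves only one letter involving 0.
transpose-0-∘ : (w : Permutation′ (suc n)) (j : Fin n) →
  Factorisation₀ w m → Factorisation₀ (transpose 0F (suc j) ∘ₚ w) (suc m)
transpose-0-∘ w j (fixed us U l w≈) =
  moved us (eval us ⟨$⟩ʳ j) U (s≤s l) λ x →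
    trans (w≈ (transpose 0F (suc j) ⟨$⟩ʳ x)) (transpose-natural (Perm.lift₀ (eval us)) 0F (suc j) x)
transpose-0-∘ w j (moved us k U l w≈) = merge (eval us ⟨$⟩ʳ j ≟ k)
  where
  open ≡-Reasoning
  u = Perm.lift₀ (eval us)
  j′ = eval us ⟨$⟩ʳ j
  w′≈ : transpose 0F (suc j) ∘ₚ w ≈ u ∘ₚ transpose 0F (suc j′) ∘ₚ transpose 0F (suc k)
  w′≈ x = trans (w≈ (transpose 0F (suc j) ⟨$⟩ʳ x))
                (cong (transpose 0F (suc k) ⟨$⟩ʳ_) (transpose-natural u 0F (suc j) x))
  merge : _ → _
  merge (yes refl) = fixed us U (ℕₚ.m≤n⇒m≤1+n (ℕₚ.<⇒≤ l)) λ x →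
    trans (w′≈ x) (transpose-involutive 0F (suc j′) (u ⟨$⟩ʳ x))
  merge (no j′≢k) = moved (us ++ (j′ , k) ∷ []) j′ (++⁺ U (j′≢k ∷ []))
    (s≤s (subst (_≤ _) (sym (trans (length-++ us) (ℕₚ.+-comm _ 1))) l)) λ x → begin
      w ⟨$⟩ʳ (transpose 0F (suc j) ⟨$⟩ʳ x)
        ≡⟨ w′≈ x ⟩
      transpose 0F (suc k) ⟨$⟩ʳ (σ ⟨$⟩ʳ (u ⟨$⟩ʳ x))
        ≡⟨ cong₂ (λ a b → transpose a b ⟨$⟩ʳ (σ ⟨$⟩ʳ (u ⟨$⟩ʳ x)))
                 (transpose-matchʳ 0F (suc j′))
                 (transpose-mismatch {i = 0F} (λ ()) (j′≢k ∘ sym ∘ suc-injective)) ⟨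
      transpose (σ ⟨$⟩ʳ suc j′) (σ ⟨$⟩ʳ suc k) ⟨$⟩ʳ (σ ⟨$⟩ʳ (u ⟨$⟩ʳ x))
        ≡⟨ transpose-natural σ (suc j′) (suc k) (u ⟨$⟩ʳ x) ⟨
      σ ⟨$⟩ʳ (transpose (suc j′) (suc k) ⟨$⟩ʳ (u ⟨$⟩ʳ x))
        ≡⟨ cong (σ ⟨$⟩ʳ_) (lift-snoc x) ⟨
      σ ⟨$⟩ʳ (Perm.lift₀ (eval (us ++ (j′ , k) ∷ [])) ⟨$⟩ʳ x) ∎
    where
    σ = transpose 0F (suc j′)
    lift-snoc : Perm.lift₀ (eval (us ++ (j′ , k) ∷ [])) ≈ u ∘ₚ transpose (suc j′) (suc k)
    lift-snoc zero    = refl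
    lift-snoc (suc x) = trans (cong suc (eval-++ us _ x))
                              (sym (lift₀-transpose j′ k (suc (eval us ⟨$⟩ʳ x))))

transpose-suc-∘ : (w : Permutation′ (suc n)) {i j : Fin n} → i ≢ j →
  Factorisation₀ w m → Factorisation₀ (transpose (suc i) (suc j) ∘ₚ w) (suc m)
transpose-suc-∘ w {i} {j} i≢j fac = factorisation-resp
  (λ x → cong (w ⟨$⟩ʳ_) (lift₀-transpose i j x)) (go fac)
  where
  lift-cons : ∀ us x → Perm.lift₀ (eval us) ⟨$⟩ʳ (Perm.lift₀ (transpose i j) ⟨$⟩ʳ x)
                     ≡ Perm.lift₀ (eval ((i , j) ∷ us)) ⟨$⟩ʳ x
  lift-cons us = Perm.lift₀-comp (transpose i j) (eval us)
  go : Factorisation₀ w m → Factorisation₀ (Perm.lift₀ (transpose i j) ∘ₚ w) (suc m)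
  go (fixed us U l w≈) = fixed ((i , j) ∷ us) (i≢j ∷ U) (s≤s l)
    λ x → trans (w≈ _) (lift-cons us x)
  go (moved us k U l w≈) = moved ((i , j) ∷ us) k (i≢j ∷ U) (s≤s l)
    λ x → trans (w≈ _) (cong (transpose 0F (suc k) ⟨$⟩ʳ_) (lift-cons us x))

factorise₀ : (ts : TranspositionList (suc n)) → All IsTransposition ts →
  Factorisation₀ (eval ts) (length ts)
factorise₀ [] [] = fixed [] [] z≤n (sym ∘ Perm.lift₀-id)
factorise₀ ((zero , zero) ∷ ts)   (0≢0 ∷ T) = contradiction refl 0≢0
factorise₀ ((zero , suc j) ∷ ts)  (_ ∷ T)   = transpose-0-∘ (eval ts) j (factorise₀ ts T)
factorise₀ ((suc i , zero) ∷ ts)  (_ ∷ T)   =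
  factorisation-resp (λ x → cong (eval ts ⟨$⟩ʳ_) (transpose-comm (suc i) 0F x))
    (transpose-0-∘ (eval ts) i (factorise₀ ts T))
factorise₀ ((suc i , suc j) ∷ ts) (i≢j ∷ T) =
  transpose-suc-∘ (eval ts) (i≢j ∘ cong suc) (factorise₀ ts T)

-- Avoidance at the first two positions.

≢0⇒0< : {x : Fin (suc n)} → x ≢ 0F → 0 ℕ.< toℕ x
≢0⇒0< {x = zero}  x≢0 = contradiction refl x≢0
≢0⇒0< {x = suc _} _   = z<s

≢0,1⇒1< : {x : Fin (suc (suc n))} → x ≢ 0F → x ≢ 1F → 1 ℕ.< toℕ x
≢0,1⇒1< {x = zero}        x≢0 _   = contradiction refl x≢0
≢0,1⇒1< {x = suc zero}    _   x≢1 = contradiction refl x≢1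
≢0,1⇒1< {x = suc (suc _)} _   _   = s≤s z<s

preimage-≢ : (w : Permutation′ n) {x y : Fin n} → w ⟨$⟩ʳ x ≢ y → w ⟨$⟩ˡ y ≢ x
preimage-≢ w wx≢y refl = wx≢y (inverseʳ w)

-- Otherwise the value 0 sits at a position `b` beyond 1. If `w` descends from 0 to 1, then 0, 1,
-- `b` form a 321. If it ascends, let `c` be the position of the value 1, which is below
-- `w ⟨$⟩ʳ 0F`: either 0, `c`, `b` form a 321 or 0, 1, `b`, `c` form a 3412.
avoids⇒corner : (w : Permutation′ (suc (suc n))) → w Avoids p321 → w Avoids p3412 →
  w ⟨$⟩ʳ 0F ≢ 0F → w ⟨$⟩ʳ 0F ≢ 1F → w ⟨$⟩ʳ 1F ≡ 0F
avoids⇒corner w ¬321 ¬3412 w0≢0 w0≢1 with w ⟨$⟩ʳ 1F ≟ 0F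
... | yes w1≡0 = w1≡0
... | no w1≢0 with <-cmp (w ⟨$⟩ʳ 1F) (w ⟨$⟩ʳ 0F)
...   | tri≈ _ w1≡w0 _ = contradiction (⟨$⟩ʳ-injective w w1≡w0) λ ()
...   | tri< w1<w0 _ _ = contradiction
  (contains321 w {0F} {1F} z<s 1<b (subst (_< (w ⟨$⟩ʳ 1F)) (sym (inverseʳ w)) (≢0⇒0< w1≢0)) w1<w0) ¬321
  where
  1<b : 1 ℕ.< toℕ (w ⟨$⟩ˡ 0F)
  1<b = ≢0,1⇒1< (preimage-≢ w w0≢0) (preimage-≢ w w1≢0)
...   | tri> _ _ w0<w1 = contradiction (cases (<-cmp c b)) [ ¬321 , ¬3412 ]
  where
  b = w ⟨$⟩ˡ 0F
  c = w ⟨$⟩ˡ 1F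
  wb<wc : (w ⟨$⟩ʳ b) < (w ⟨$⟩ʳ c)
  wb<wc = subst₂ _<_ (sym (inverseʳ w)) (sym (inverseʳ w)) z<s
  wc<w0 : (w ⟨$⟩ʳ c) < (w ⟨$⟩ʳ 0F)
  wc<w0 = subst (_< (w ⟨$⟩ʳ 0F)) (sym (inverseʳ w)) (≢0,1⇒1< w0≢0 w0≢1)
  1<b : 1 ℕ.< toℕ b
  1<b = ≢0,1⇒1< (preimage-≢ w w0≢0) (preimage-≢ w w1≢0)
  0<c : 0 ℕ.< toℕ c
  0<c = ≢0⇒0< (preimage-≢ w w0≢1)
  cases : _ → w Contains p321 ⊎ w Contains p3412
  cases (tri< c<b _ _) = inj₁ (contains321 w {0F} 0<c c<b wb<wc wc<w0)
  cases (tri≈ _ c≡b _) = contradiction (cong (w ⟨$⟩ʳ_) (sym c≡b)) (<⇒≢ wb<wc)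
  cases (tri> _ _ b<c) = inj₂ (contains3412 w {0F} {1F} z<s 1<b b<c wb<wc wc<w0 w0<w1)

-- Deleting one entry of a permutation.

punchIn-1-mono : punchIn {suc n} 1F Preserves _<_ ⟶ _<_
punchIn-1-mono {x = zero}  {suc y} _         = z<s
punchIn-1-mono {x = suc x} {suc y} (s≤s x<y) = s≤s (s≤s x<y)

fixed⇒contains : (w : Permutation′ (suc n)) (u : Permutation′ n) →
  w ≈ Perm.lift₀ u → w Contains u
fixed⇒contains w u w≈ =
  embedding⇒contains w u suc suc s≤s s≤s (w≈ ∘ suc)

module _ (w : Permutation′ (suc (suc n))) (u : Permutation′ (suc n)) where

  -- The deleted entry is the value 1 at position 0; `punchIn 1F` lists the remaining values.
  lift-∘-s₀⇒contains : w ≈ Perm.lift₀ u ∘ₚ transpose 0F 1F → w Contains u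
  lift-∘-s₀⇒contains w≈ = embedding⇒contains w u suc (punchIn 1F) s≤s punchIn-1-mono
    λ x → trans (w≈ (suc x)) (value (u ⟨$⟩ʳ x))
    where
    value : ∀ y → transpose 0F 1F ⟨$⟩ʳ suc y ≡ punchIn 1F y
    value zero    = refl
    value (suc y) = refl

  -- Here the deleted entry is the value 0 at position 1.
  s₀-∘-lift⇒contains : w ≈ transpose 0F 1F ∘ₚ Perm.lift₀ u → w Contains u
  s₀-∘-lift⇒contains w≈ = embedding⇒contains w u (punchIn 1F) suc punchIn-1-mono s≤s
    λ { zero → w≈ 0F ; (suc x) → w≈ (suc (suc x)) }

AvoidsBoth : Permutation′ n → Set
AvoidsBoth w = w Avoids p321 × w Avoids p3412

contains-avoidsBoth : (w : Permutation′ n) (u : Permutation′ m) →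
  w Contains u → AvoidsBoth w → AvoidsBoth u
contains-avoidsBoth w u w⊇u (¬321 , ¬3412) =
  ¬321 ∘ contains-trans w u p321 w⊇u , ¬3412 ∘ contains-trans w u p3412 w⊇u

-- Construction of short adjacent words.

eval-lift-cong : {u : Permutation′ n} (vs : TranspositionList n) → eval vs ≈ u →
  eval (lift₀ vs) ≈ Perm.lift₀ u
eval-lift-cong vs vs≈u x = trans (eval-lift vs x) (lift₀-cong (eval vs) _ vs≈u x)

AdjacentWord : Permutation′ n → ℕ → Set
AdjacentWord {n} w m =
  Σ (TranspositionList n) λ vs → All IsAdjacent vs × length vs ≤ m × eval vs ≈ w

lift-word : (u : Permutation′ n) → AdjacentWord u m → AdjacentWord (Perm.lift₀ u) m
lift-word u (vs , A , l , vs≈) =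
  lift₀ vs , lift₀-adjacent A , subst (_≤ _) (sym (length-map _ vs)) l , eval-lift-cong vs vs≈

snoc-word : (u : Permutation′ n) (i j : Fin n) → IsAdjacent (i , j) →
  AdjacentWord u m → AdjacentWord (u ∘ₚ transpose i j) (suc m)
snoc-word u i j adj (vs , A , l , vs≈) =
  vs ++ (i , j) ∷ [] , ++⁺ A (adj ∷ [])
  , subst (_≤ _) (sym (trans (length-++ vs) (ℕₚ.+-comm _ 1))) (s≤s l)
  , λ x → trans (eval-++ vs _ x) (cong (transpose i j ⟨$⟩ʳ_) (vs≈ x))

cons-word : (u : Permutation′ n) (i j : Fin n) → IsAdjacent (i , j) →
  AdjacentWord u m → AdjacentWord (transpose i j ∘ₚ u) (suc m)
cons-word u i j adj (vs , A , l , vs≈) =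
  (i , j) ∷ vs , adj ∷ A , s≤s l , vs≈ ∘ (transpose i j ⟨$⟩ʳ_)

word-resp : (v w : Permutation′ n) → v ≈ w → m ≤ k → AdjacentWord w m → AdjacentWord v k
word-resp v w v≈w m≤k (vs , A , l , vs≈) =
  vs , A , ℕₚ.≤-trans l m≤k , λ x → trans (vs≈ x) (sym (v≈w x))

shortAdjacentWord : (ts : TranspositionList n) → All IsTransposition ts →
  AvoidsBoth (eval ts) → AdjacentWord (eval ts) (length ts)
shortAdjacentWord {zero} ts T av = [] , [] , z≤n , λ ()
shortAdjacentWord {suc n} ts T av with factorise₀ ts T
... | fixed us U l w≈ =
  word-resp (eval ts) (Perm.lift₀ u) w≈ l (lift-word u (shortAdjacentWord us U
    (contains-avoidsBoth (eval ts) u (fixed⇒contains (eval ts) u w≈) av)))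
  where
  u = eval us
shortAdjacentWord {suc (suc n)} ts T av | moved us zero U l w≈ =
  word-resp (eval ts) (Perm.lift₀ u ∘ₚ transpose 0F 1F) w≈ l
    (snoc-word (Perm.lift₀ u) 0F 1F refl (lift-word u (shortAdjacentWord us U
      (contains-avoidsBoth (eval ts) u (lift-∘-s₀⇒contains (eval ts) u w≈) av))))
  where
  u = eval us
shortAdjacentWord {suc (suc n)} ts T av@(¬321 , ¬3412) | moved us (suc k) U l w≈ =
  word-resp w (transpose 0F 1F ∘ₚ Perm.lift₀ u) w≈′ l
    (cons-word (Perm.lift₀ u) 0F 1F refl (lift-word u (shortAdjacentWord us U
      (contains-avoidsBoth w u (s₀-∘-lift⇒contains w u w≈′) av))))
  where
  w = eval ts
  u = eval us
  w0 : w ⟨$⟩ʳ 0F ≡ suc (suc k)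
  w0 = w≈ 0F
  w1 : w ⟨$⟩ʳ 1F ≡ 0F
  w1 = avoids⇒corner w ¬321 ¬3412
    (λ w0≡0 → contradiction (trans (sym w0) w0≡0) λ ())
    (λ w0≡1 → contradiction (trans (sym w0) w0≡1) λ ())
  -- `w` sends 1 to 0 and its last factor exchanges 0 with `suc (suc k)`, so `Perm.lift₀ u` must
  -- send 1 to `suc (suc k)`.
  u0 : suc (suc k) ≡ suc (u ⟨$⟩ʳ 0F)
  u0 = ⟨$⟩ʳ-injective (transpose 0F (suc (suc k)))
    (trans (transpose-matchʳ 0F (suc (suc k))) (trans (sym w1) (w≈ 1F)))
  -- Hence the last factor is the conjugate of `(0 1)` by `Perm.lift₀ u` and can be moved to the
  -- front.
  w≈′ : w ≈ transpose 0F 1F ∘ₚ Perm.lift₀ u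
  w≈′ x = trans (w≈ x) (trans
    (cong (λ y → transpose 0F y ⟨$⟩ʳ (Perm.lift₀ u ⟨$⟩ʳ x)) u0)
    (sym (transpose-natural (Perm.lift₀ u) 0F 1F x)))

-- Comparison of the two lengths.

ℓT≤ℓS : (w : Permutation′ n) → ℓT w ≤ ℓS w
ℓT≤ℓS w with _ , (ts , len , A , ts≈w) , _ ← leastS w =
  proj₂ (proj₂ (leastT w)) _ (ts , len , All.map adjacent⇒transposition A , ts≈w)

-- A word represents a permutation only up to `≈`, so avoidance has to be carried along pointwise
-- equality.
avoids-resp : (w u : Permutation′ n) (p : Permutation′ k) → w ≈ u → u Avoids p → w Avoids p
avoids-resp w u p w≈u ¬p =
  ¬p ∘ contains-trans u w p (embedding⇒contains u w (λ x → x) (λ x → x) (λ lt → lt) (λ lt → lt) (sym ∘ w≈u))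

avoids⇒ℓS≤ℓT : (w : Permutation′ n) → AvoidsBoth w → ℓS w ≤ ℓT w
avoids⇒ℓS≤ℓT w (¬321 , ¬3412) with _ , (ts , refl , T , ts≈w) , _ ← leastT w
  with vs , A , l , vs≈ ← shortAdjacentWord ts T
         (avoids-resp (eval ts) w p321 ts≈w ¬321 , avoids-resp (eval ts) w p3412 ts≈w ¬3412) =
  ℕₚ.≤-trans (proj₂ (proj₂ (leastS w)) _ (vs , refl , A , λ x → trans (vs≈ x) (ts≈w x))) l

ℓS≡ℓT⇒avoids : (w : Permutation′ n) → ℓS w ≡ ℓT w → AvoidsBoth w
ℓS≡ℓT⇒avoids w eq with m , (ts , len , A , ts≈w) , _ ← leastS w =
  avoids {p = p321} tangled321 , avoids {p = p3412} tangled3412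
  where
  -- The equality of lengths enters here: the shortest adjacent word `ts` has length `ℓT w`.
  minimal : Minimal ts
  minimal us U us≈ = subst (_≤ length us) (sym (trans len eq))
    (proj₂ (proj₂ (leastT w)) _ (us , refl , U , λ x → trans (us≈ x) (ts≈w x)))
  avoids : {p : Permutation′ (suc k)} → Tangled p → w Avoids p
  avoids {p = p} tangled = avoids-resp w (eval ts) p (sym ∘ ts≈w)
    (unique⇒avoids {p = p} tangled A (minimal⇒unique (All.map adjacent⇒transposition A) minimal))

theorem4p7 : (n : ℕ) (w : Permutation′ n) → (ℓS w ≡ ℓT w) ⇔ ((w Avoids p321) × (w Avoids p3412))
theorem4p7 n w = mk⇔ (ℓS≡ℓT⇒avoids w)
  (λ av → ℕₚ.≤-antisym (avoids⇒ℓS≤ℓT w av) (ℓT≤ℓS w))
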